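{- Let $n$ and $\Delta$ be positive integers and let $T$ be a tree on $n$ vertices with maximum vertex degree $\Delta$ such that $T$ is not isomorphic to the broom $B(n,\Delta)$. Then $$ecc(B(n,\Delta)) > ecc(T).$$
   Context: For a connected graph $H$ on vertex set $V$ with $|V|=n$, the eccentricity of a vertex $v$ is $\varepsilon(v)=\max_{u\in V} d(u,v)$ ($d$ the shortest-path distance), and $ecc(H)=\frac{1}{n}\sum_{v\in V}\varepsilon(v)$ is the average eccentricity. The broom $B(n,\Delta)$ is the tree on $n$ vertices consisting of a star $S_{\Delta+1}$ (a center joined to $\Delta$ leaves) together with a path of length $n-\Delta-1$ attached to one of the pendent vertices of the star (i.e. the pendent vertex of the star is an end vertex of a path with $n-\Delta-1$ further new vertices). -}

module Defs where

open import Data.Bool using (Bool; true; false; _∧_; _∨_; if_then_else_)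
open import Data.Nat using (ℕ; zero; suc; _+_; _≤_; _<_; _⊔_; _≡ᵇ_; _≤ᵇ_; _<ᵇ_; NonZero)
open import Data.Fin using (Fin; toℕ)
open import Data.List using (List; []; _∷_; _++_; [_]; length; map; foldr; allFin)
open import Data.Nat.ListAction using (sum)
open import Data.Bool.ListAction using (any)
open import Data.List.Relation.Unary.Unique.Propositional using (Unique)
open import Data.List.Relation.Unary.Linked using (Linked)
open import Data.Product using (Σ; ∃; _×_)
open import Data.Integer using (+_)
open import Data.Rational using (ℚ; _/_)
open import Data.Fin.Permutation using (Permutation′; _⟨$⟩ʳ_)
open import Relation.Binary.PropositionalEquality using (_≡_)
open import Relation.Nullary using (¬_)

Graph : ℕ → Set
Graph n = Fin n → Fin n → Bool

Edge : ∀ {n} → Graph n → Fin n → Fin n → Set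
Edge G u v = G u v ≡ true

IsSimple : ∀ {n} → Graph n → Set
IsSimple {n} G = (∀ u v → G u v ≡ G v u) × (∀ v → G v v ≡ false)

data Walk {n} (G : Graph n) : Fin n → Fin n → ℕ → Set where
  here : ∀ {v} → Walk G v v 0
  step : ∀ {u w v k} → Edge G u w → Walk G w v k → Walk G u v (suc k)

Connected : ∀ {n} → Graph n → Set
Connected {n} G = ∀ u v → ∃ λ k → Walk G u v k

HasCycle : ∀ {n} → Graph n → Set
HasCycle {n} G = Σ (Fin n) λ v → Σ (List (Fin n)) λ ws →
  Unique (v ∷ ws) × (2 ≤ length ws) × Linked (Edge G) (v ∷ ws ++ [ v ])

IsTree : ∀ {n} → Graph n → Set
IsTree G = IsSimple G × Connected G × ¬ HasCycle G

degree : ∀ {n} → Graph n → Fin n → ℕ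
degree {n} G v = sum (map (λ u → if G v u then 1 else 0) (allFin n))

MaxDegree : ∀ {n} → Graph n → ℕ → Set
MaxDegree {n} G Δ = (∀ v → degree G v ≤ Δ) × ∃ λ v → degree G v ≡ Δ

Isomorphic : ∀ {n} → Graph n → Graph n → Set
Isomorphic {n} G H = Σ (Permutation′ n) λ σ → ∀ u v → G u v ≡ H (σ ⟨$⟩ʳ u) (σ ⟨$⟩ʳ v)

within : ∀ {n} → Graph n → ℕ → Fin n → Fin n → Bool
within G zero u v = (toℕ u ≡ᵇ toℕ v)
within {n} G (suc k) u v = within G k u v ∨ any (λ w → G u w ∧ within G k w v) (allFin n)

-- least j ≥ k (searching `fuel` steps) with p j; default the last index
firstFrom : (ℕ → Bool) → ℕ → ℕ → ℕ
firstFrom p k zero = k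
firstFrom p k (suc f) = if p k then k else firstFrom p (suc k) f

-- shortest-path distance d(u,v) = least k such that a walk of length ≤ k
-- from u to v exists (in a connected graph on n vertices, d(u,v) < n)
dist : ∀ {n} → Graph n → Fin n → Fin n → ℕ
dist {n} G u v = firstFrom (λ k → within G k u v) 0 n

eccentricity : ∀ {n} → Graph n → Fin n → ℕ
eccentricity {n} G v = foldr _⊔_ 0 (map (λ u → dist G u v) (allFin n))

ecc : ∀ {n} .{{_ : NonZero n}} → Graph n → ℚ
ecc {n} G = (+ sum (map (eccentricity G) (allFin n))) / n

-- The broom B(n,Δ) on Fin n (meaningful when n ≥ Δ + 1):
-- centre 0 adjacent to 1,…,Δ; path Δ – (Δ+1) – … – (n-1).
broomAdj : ℕ → ℕ → ℕ → Bool
broomAdj Δ i j =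
     ((i ≡ᵇ 0) ∧ ((1 ≤ᵇ j) ∧ (j ≤ᵇ Δ)))
  ∨ ((j ≡ᵇ 0) ∧ ((1 ≤ᵇ i) ∧ (i ≤ᵇ Δ)))
  ∨ ((Δ ≤ᵇ i) ∧ (j ≡ᵇ suc i))
  ∨ ((Δ ≤ᵇ j) ∧ (i ≡ᵇ suc j))

broom : (n Δ : ℕ) → Graph n
broom n Δ u v = broomAdj Δ (toℕ u) (toℕ v)

{-# OPTIONS --safe #-}

-- Let p₀ – … – p_d be a diametral path of T and r the number of vertices off it. In a tree the
-- distances from a fixed vertex u to the pᵢ first decrease and then increase, so the eccentricity
-- of pᵢ is max(i, d − i), and that of the other vertices is at most d. Hence the eccentricities of
-- T sum to at most F(d) + r d with F(d) = Σᵢ max(i, d − i). A vertex of degree Δ has at most two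
-- neighbours on the path, so Δ ≤ r + 2, that is d ≤ D := n − Δ + 1, the diameter of the broom,
-- whose eccentricities sum to F(D) + (Δ − 2) D. As F(d) + d < F(d + 1), only d = D can give
-- equality; then all vertices off the path hang at one pₖ, they have eccentricity less than d
-- unless k = 1 or k = d − 1, and in these two cases T is the broom.

module Submission where

open import Defs
open import Data.Bool using (true; false; T; _∧_; if_then_else_)
import Data.Bool.Properties as Bool
open import Data.Bool.Properties using (T-∨; T-∧; T-≡)
open import Data.Fin using (Fin; toℕ; fromℕ<; _≟_) renaming (zero to fzero; suc to fsuc)
open import Data.Fin.Permutation as Permutation using (Permutation′; permutation; _⟨$⟩ʳ_)
open import Data.Fin.Properties using (pigeonhole; toℕ<n; toℕ-fromℕ<; toℕ-injective)
import Data.Integer as ℤ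
open import Data.Integer.Properties using (*-monoʳ-<-pos)
open import Data.List using (List; []; _∷_; _++_; [_]; length; map; filter; allFin; tabulate; applyUpTo)
open import Data.List.Extrema as Extrema using ()
open import Data.List.Membership.Propositional using (_∈_; _∉_; find)
open import Data.List.Membership.Propositional.Properties
open import Data.List.Membership.Propositional.Properties.WithK using (unique∧set⇒bag)
open import Data.List.Properties using (applyUpTo-∷ʳ; length-tabulate; length-applyUpTo; length-++; length-map; map-applyUpTo; map-tabulate; map-++; foldr-preservesᵇ; foldr-forcesᵇ)
open import Data.List.Relation.Binary.BagAndSetEquality using (∼bag⇒↭)
open import Data.List.Relation.Binary.Permutation.Propositional using (_↭_)
open import Data.List.Relation.Binary.Permutation.Propositional.Properties using (↭-length; shift; map⁺)
open import Data.List.Relation.Binary.Subset.Propositional using (_⊆_)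
open import Data.List.Relation.Unary.All as All using (All; []; _∷_)
import Data.List.Relation.Unary.All.Properties as All
open import Data.List.Relation.Unary.AllPairs using ([]; _∷_)
open import Data.List.Relation.Unary.Any as Any using (here; there)
import Data.List.Relation.Unary.Any.Properties as Any
open import Data.List.Relation.Unary.Linked using (Linked; [-]; _∷_)
open import Data.List.Relation.Unary.Unique.Propositional using (Unique)
import Data.List.Relation.Unary.Unique.Propositional.Properties as Unique
open import Data.Nat hiding (_≟_; _>_; _/_)
open import Data.Nat.Induction using (<-wellFounded)
open import Data.Nat.ListAction using (sum)
open import Data.Nat.ListAction.Properties using (sum-++; sum-↭)
open import Data.Nat.Properties hiding (_≟_)
open import Data.Nat.Tactic.RingSolver using (solve-∀)
open import Data.Product using (Σ; ∃; _×_; _,_; proj₁; proj₂)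
open import Data.Rational using (_>_; _/_)
open import Data.Rational.Properties using (toℚᵘ-cancel-<; toℚᵘ-fromℚᵘ)
open import Data.Rational.Unnormalised using (mkℚᵘ; *<*)
import Data.Rational.Unnormalised.Properties as ℚᵘ
open import Data.Sum using (_⊎_; inj₁; inj₂; [_,_]′)
open import Function using (_∘_; id; mk⇔)
open import Function.Bundles using (module Equivalence)
open import Induction.WellFounded using (Acc; acc)
open import Relation.Binary using (tri<; tri≈; tri>)
open import Relation.Binary.PropositionalEquality hiding ([_])
open import Relation.Nullary using (¬_; yes; no; contradiction; ¬?)
open Equivalence using (to; from)
open Extrema ≤-totalOrder using (argmax; f[xs]≤f[argmax])

private
  variable
    n : ℕ

-- Lists without repetition

unique-⊆⇒length≤ : ∀ {A : Set} {xs ys : List A} → Unique xs → xs ⊆ ys → length xs ≤ length ys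
unique-⊆⇒length≤ {xs = []} _ _ = z≤n
unique-⊆⇒length≤ {xs = x ∷ xs} (x∉xs ∷ u) sub with ∈-∃++ (sub (here refl))
... | as , bs , refl = ≤-trans (s≤s (unique-⊆⇒length≤ u sub′))
                               (≤-reflexive (sym (↭-length (shift x as bs))))
  where
  sub′ : xs ⊆ as ++ bs
  sub′ z∈xs with ∈-++⁻ as (sub (there z∈xs))
  ... | inj₁ z∈as = ∈-++⁺ˡ z∈as
  ... | inj₂ (here refl) = contradiction refl (All.lookup x∉xs z∈xs)
  ... | inj₂ (there z∈bs) = ∈-++⁺ʳ as z∈bs

-- A missing `y` could be put in front of `xs`, giving a repetition-free list inside `ys` that is
-- too long.
unique-⊆-length≥⇒⊇ : {xs ys : List (Fin n)} → Unique xs → xs ⊆ ys →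
                     length ys ≤ length xs → ys ⊆ xs
unique-⊆-length≥⇒⊇ {xs = xs} {ys} u sub len {y} y∈ys with Any.any? (y ≟_) xs
... | yes y∈xs = y∈xs
... | no y∉xs = contradiction
  (≤-trans (unique-⊆⇒length≤ {xs = y ∷ xs} (All.¬Any⇒All¬ xs y∉xs ∷ u) sub′) len) 1+n≰n
  where
  sub′ : y ∷ xs ⊆ ys
  sub′ (here refl) = y∈ys
  sub′ (there p) = sub p

unique-allFin : ∀ n → Unique (allFin n)
unique-allFin n = Unique.tabulate⁺ id

length-allFin : ∀ n → length (allFin n) ≡ n
length-allFin n = length-tabulate id

-- The images of all elements form a repetition-free list of length `n`, which must exhaust
-- `allFin n`.
injective⇒surjective : (g : Fin n → Fin n) → (∀ {x y} → g x ≡ g y → x ≡ y) → ∀ y → ∃ λ x → y ≡ g x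
injective⇒surjective {n} g inj y =
  let x , _ , eq = ∈-map⁻ g (unique-⊆-length≥⇒⊇ (Unique.map⁺ inj (unique-allFin n)) (λ _ → ∈-allFin _)
                     (≤-reflexive (sym (length-map g (allFin n)))) (∈-allFin y))
  in x , eq

complement : List (Fin n) → List (Fin n)
complement {n} xs = filter (λ v → ¬? (Any.any? (v ≟_) xs)) (allFin n)

∈-complement⁺ : ∀ {xs} {v : Fin n} → v ∉ xs → v ∈ complement xs
∈-complement⁺ = ∈-filter⁺ _ (∈-allFin _)

∈-complement⁻ : ∀ {xs} {v : Fin n} → v ∈ complement xs → v ∉ xs
∈-complement⁻ {n} = proj₂ ∘ ∈-filter⁻ _ {xs = allFin n}

-- Two repetition-free lists with the same members are permutations of each other. Sums over all
-- vertices thereby split into a part on the path and a part off it.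
++-complement-↭ : (xs : List (Fin n)) → Unique xs → xs ++ complement xs ↭ allFin n
++-complement-↭ {n} xs u = ∼bag⇒↭ (unique∧set⇒bag
  (Unique.++⁺ u (Unique.filter⁺ _ (unique-allFin n)) (λ (p , q) → ∈-complement⁻ {xs = xs} q p))
  (unique-allFin n)
  (mk⇔ (λ _ → ∈-allFin _) (λ _ → cover _)))
  where
  cover : ∀ v → v ∈ xs ++ complement xs
  cover v with Any.any? (v ≟_) xs
  ... | yes p = ∈-++⁺ˡ p
  ... | no p = ∈-++⁺ʳ xs (∈-complement⁺ p)

length-complement : (xs : List (Fin n)) → Unique xs → length xs + length (complement xs) ≡ n
length-complement {n} xs u = trans (sym (length-++ xs)) (trans (↭-length (++-complement-↭ xs u)) (length-allFin n))

sum-map-complement : (f : Fin n → ℕ) (xs : List (Fin n)) → Unique xs →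
  sum (map f (allFin n)) ≡ sum (map f xs) + sum (map f (complement xs))
sum-map-complement f xs u = trans (sym (sum-↭ (map⁺ f (++-complement-↭ xs u))))
  (trans (cong sum (map-++ f xs (complement xs))) (sum-++ (map f xs) _))

sum-map-mono : ∀ {A : Set} {f g : A → ℕ} xs → (∀ {x} → x ∈ xs → f x ≤ g x) → sum (map f xs) ≤ sum (map g xs)
sum-map-mono [] _ = z≤n
sum-map-mono (x ∷ xs) h = +-mono-≤ (h (here refl)) (sum-map-mono xs (h ∘ there))

sum-map-≤ : ∀ {A : Set} {f : A → ℕ} b xs → (∀ {x} → x ∈ xs → f x ≤ b) → sum (map f xs) ≤ length xs * b
sum-map-≤ b [] _ = z≤n
sum-map-≤ b (x ∷ xs) h = +-mono-≤ (h (here refl)) (sum-map-≤ b xs (h ∘ there))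

-- Walks and distances

neighbours : Graph n → Fin n → List (Fin n)
neighbours {n} G v = filter (λ u → G v u Bool.≟ true) (allFin n)

∈-neighbours⁺ : ∀ (G : Graph n) {v u} → Edge G v u → u ∈ neighbours G v
∈-neighbours⁺ _ = ∈-filter⁺ _ (∈-allFin _)

∈-neighbours⁻ : ∀ (G : Graph n) {v u} → u ∈ neighbours G v → Edge G v u
∈-neighbours⁻ {n} _ = proj₂ ∘ ∈-filter⁻ _ {xs = allFin n}

unique-neighbours : ∀ (G : Graph n) v → Unique (neighbours G v)
unique-neighbours {n} G v = Unique.filter⁺ _ (unique-allFin n)

length-neighbours : ∀ (G : Graph n) v → length (neighbours G v) ≡ degree G v
length-neighbours {n} G v = go (allFin n)
  where
  go : ∀ xs → length (filter (λ u → G v u Bool.≟ true) xs) ≡ sum (map (λ u → if G v u then 1 else 0) xs)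
  go [] = refl
  go (x ∷ xs) with G v x
  ... | true = cong suc (go xs)
  ... | false = go xs

module _ {G : Graph n} where

  _++ʷ_ : ∀ {u v w j k} → Walk G u v j → Walk G v w k → Walk G u w (j + k)
  here ++ʷ q = q
  step e p ++ʷ q = step e (p ++ʷ q)

  reverseʷ : (∀ u v → G u v ≡ G v u) → ∀ {u v k} → Walk G u v k → Walk G v u k
  reverseʷ s here = here
  reverseʷ s {u} {v} {suc k} (step {w = w} e p) =
    subst (Walk G v u) (+-comm k 1) (reverseʷ s p ++ʷ step (trans (s w u) e) here)

  -- Total in the index: past the end it stays at the last vertex, so a path can be a function on
  -- `ℕ`.
  vertexAt : ∀ {u v k} → Walk G u v k → ℕ → Fin n
  vertexAt {u} here _ = u
  vertexAt {u} (step _ _) zero = u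
  vertexAt (step _ p) (suc j) = vertexAt p j

  takeʷ : ∀ {u v k} (p : Walk G u v k) {j} → j ≤ k → Walk G u (vertexAt p j) j
  takeʷ here z≤n = here
  takeʷ (step _ _) z≤n = here
  takeʷ (step e p) (s≤s j≤k) = step e (takeʷ p j≤k)

  dropʷ : ∀ {u v k} (p : Walk G u v k) {j} → j ≤ k → Walk G (vertexAt p j) v (k ∸ j)
  dropʷ here z≤n = here
  dropʷ (step e p) z≤n = step e p
  dropʷ (step e p) (s≤s j≤k) = dropʷ p j≤k

  vertexAt-edge : ∀ {u v k} (p : Walk G u v k) {j} → j < k → Edge G (vertexAt p j) (vertexAt p (suc j))
  vertexAt-edge (step e here) {zero} (s≤s z≤n) = e
  vertexAt-edge (step e (step _ _)) {zero} (s≤s z≤n) = e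
  vertexAt-edge (step e p) {suc j} (s≤s j<k) = vertexAt-edge p j<k

  vertexAt-start : ∀ {u v k} (p : Walk G u v k) → vertexAt p 0 ≡ u
  vertexAt-start here = refl
  vertexAt-start (step _ _) = refl

  vertexAt-end : ∀ {u v k} (p : Walk G u v k) → vertexAt p k ≡ v
  vertexAt-end here = refl
  vertexAt-end (step _ p) = vertexAt-end p

  -- A walk of length at least `n` visits some vertex twice; the closed piece in between is cut out,
  -- by recursion on the length. This matters because `dist` searches only up to `n`.
  shorten : ∀ {u v k} → Walk G u v k → ∃ λ j → j < n × Walk G u v j
  shorten {k = k} = go (<-wellFounded k)
    where
    go : ∀ {u v k} → Acc _<_ k → Walk G u v k → ∃ λ j → j < n × Walk G u v j
    go {u} {v} {k} (acc rec) p with k <? n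
    ... | yes k<n = k , k<n , p
    ... | no k≮n with pigeonhole (s≤s (≮⇒≥ k≮n)) (vertexAt p ∘ toℕ)
    ... | i , j , i<j , eq = go (rec shorter)
      (takeʷ p i≤k ++ʷ subst (λ x → Walk G x v (k ∸ toℕ j)) (sym eq) (dropʷ p j≤k))
      where
      j≤k : toℕ j ≤ k
      j≤k = ≤-pred (toℕ<n j)
      i≤k : toℕ i ≤ k
      i≤k = ≤-trans (<⇒≤ i<j) j≤k
      shorter : toℕ i + (k ∸ toℕ j) < k
      shorter = <-≤-trans (+-monoˡ-< (k ∸ toℕ j) i<j) (≤-reflexive (m+[n∸m]≡n j≤k))

  within⁻ : ∀ k {u v} → T (within G k u v) → ∃ λ j → j ≤ k × Walk G u v j
  within⁻ zero {u} {v} t with refl ← toℕ-injective {i = u} {v} (≡ᵇ⇒≡ _ _ t) = 0 , z≤n , here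
  within⁻ (suc k) {u} t with T-∨ .to t
  ... | inj₁ s = let j , j≤k , p = within⁻ k s in j , m≤n⇒m≤1+n j≤k , p
  ... | inj₂ s with Any.satisfied (Any.any⁻ _ (allFin n) s)
  ... | w , s′ with T-∧ .to s′
  ... | e , s″ = let j , j≤k , p = within⁻ k s″ in suc j , s≤s j≤k , step (T-≡ .to e) p

  within⁺ : ∀ {k u v} → Walk G u v k → T (within G k u v)
  within⁺ {v = v} here = ≡⇒≡ᵇ (toℕ v) (toℕ v) refl
  within⁺ {u = u} (step {w = w} e p) = T-∨ .from (inj₂ (Any.any⁺ _
    (Any.map (λ where refl → T-∧ .from (T-≡ .from e , within⁺ p)) (∈-allFin w))))

-- A failed search returns `k + f`, a value that certifies nothing about `p`.
firstFrom-hit : ∀ p k f → firstFrom p k f ≡ k + f ⊎ T (p (firstFrom p k f))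
firstFrom-hit p k zero = inj₁ (sym (+-identityʳ k))
firstFrom-hit p k (suc f) with p k in eq
... | true = inj₂ (T-≡ .from eq)
... | false = [ (λ e → inj₁ (trans e (sym (+-suc k f)))) , inj₂ ]′ (firstFrom-hit p (suc k) f)

firstFrom-least : ∀ p k f {j} → k ≤ j → T (p j) → firstFrom p k f ≤ j
firstFrom-least p k zero k≤j _ = k≤j
firstFrom-least p k (suc f) {j} k≤j t with p k in eq
... | true = k≤j
... | false = firstFrom-least p (suc k) f (≤∧≢⇒< k≤j λ where refl → subst T eq t) t

module _ {G : Graph n} where

  dist-≤ : ∀ {u v k} → Walk G u v k → dist G u v ≤ k
  dist-≤ p = firstFrom-least _ 0 n z≤n (within⁺ p)

  -- The search cannot have failed: its default `n` would exceed the length of a shortened walk.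
  dist-walk : ∀ {u v k} → Walk G u v k → Walk G u v (dist G u v)
  dist-walk {u} {v} p with firstFrom-hit (λ k → within G k u v) 0 n
  ... | inj₁ eq = let j , j<n , q = shorten p in
        contradiction (≤-<-trans (≤-trans (≤-reflexive (sym eq)) (dist-≤ q)) j<n) (<-irrefl refl)
  ... | inj₂ t = let j , j≤d , q = within⁻ _ t in subst (Walk G u v) (≤-antisym j≤d (dist-≤ q)) q

  walk-lipschitz : (f : Fin n → ℕ) → (∀ {u v} → Edge G u v → ∣ f u - f v ∣ ≤ 1) →
                   ∀ {u v k} → Walk G u v k → ∣ f u - f v ∣ ≤ k
  walk-lipschitz f lip {u} here = ≤-reflexive (∣n-n∣≡0 (f u))
  walk-lipschitz f lip {u} {v} (step {w = w} e p) =
    ≤-trans (∣-∣-triangle (f u) (f w) (f v)) (+-mono-≤ (lip e) (walk-lipschitz f lip p))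

  -- Unreachable pairs get the junk distance n, hence the bound on f.
  dist-lipschitz : (f : Fin n → ℕ) → (∀ {u v} → Edge G u v → ∣ f u - f v ∣ ≤ 1) →
                   (∀ v → f v ≤ n) → ∀ u v → ∣ f u - f v ∣ ≤ dist G u v
  dist-lipschitz f lip bd u v with firstFrom-hit (λ k → within G k u v) 0 n
  ... | inj₁ eq = ≤-trans (∣m-n∣≤m⊔n (f u) (f v)) (≤-trans (⊔-lub (bd u) (bd v)) (≤-reflexive (sym eq)))
  ... | inj₂ t = let j , j≤d , q = within⁻ _ t in ≤-trans (walk-lipschitz f lip q) j≤d

  dist≤eccentricity : ∀ u v → dist G u v ≤ eccentricity G v
  dist≤eccentricity u v = All.lookup (All.map⁻ (foldr-forcesᵇ {P = _≤ eccentricity G v}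
    (λ x y le → m⊔n≤o⇒m≤o x y le , m⊔n≤o⇒n≤o x y le) 0 (map (λ u → dist G u v) (allFin n)) ≤-refl)) (∈-allFin u)

  eccentricity-≤ : ∀ {b v} → (∀ u → dist G u v ≤ b) → eccentricity G v ≤ b
  eccentricity-≤ {b} {v} h = foldr-preservesᵇ {P = _≤ b} ⊔-lub z≤n
    (All.map⁺ (All.tabulate {xs = allFin n} (λ {u} _ → h u)))

-- Distances in trees

linked-∷ʳ : ∀ {A : Set} {R : A → A → Set} xs {a b} →
  Linked R (xs ++ [ a ]) → R a b → Linked R ((xs ++ [ a ]) ++ [ b ])
linked-∷ʳ [] [-] r = r ∷ [-]
linked-∷ʳ (x ∷ []) (q ∷ l) r = q ∷ linked-∷ʳ [] l r
linked-∷ʳ (x ∷ y ∷ xs) (q ∷ l) r = q ∷ linked-∷ʳ (y ∷ xs) l r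

module Tree (G : Graph n) (tree : IsTree G) where

  edge-sym : ∀ {u v} → Edge G u v → Edge G v u
  edge-sym {u} {v} e = trans (proj₁ (proj₁ tree) v u) e

  edge-irrefl : ∀ {v} → ¬ Edge G v v
  edge-irrefl {v} e with () ← trans (sym e) (proj₂ (proj₁ tree) v)

  δ : Fin n → Fin n → ℕ
  δ = dist G

  geodesic : ∀ u v → Walk G u v (δ u v)
  geodesic u v = dist-walk (proj₂ (proj₁ (proj₂ tree) u v))

  δ-sym : ∀ u v → δ u v ≡ δ v u
  δ-sym u v = ≤-antisym (le u v) (le v u)
    where
    le : ∀ u v → δ u v ≤ δ v u
    le u v = dist-≤ (reverseʷ (proj₁ (proj₁ tree)) (geodesic v u))

  δ-triangle : ∀ u v w → δ u w ≤ δ u v + δ v w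
  δ-triangle u v w = dist-≤ (geodesic u v ++ʷ geodesic v w)

  δ-refl : ∀ v → δ v v ≡ 0
  δ-refl v = n≤0⇒n≡0 (dist-≤ {G = G} (here {v = v}))

  δ≡0⇒≡ : ∀ {u v} → δ u v ≡ 0 → u ≡ v
  δ≡0⇒≡ {u} {v} eq with here ← subst (Walk G u v) eq (geodesic u v) = refl

  δ-edge : ∀ {u v} → Edge G u v → δ u v ≡ 1
  δ-edge {u} e = ≤-antisym (dist-≤ {G = G} (step e here))
    (n≢0⇒n>0 λ eq → edge-irrefl (subst (Edge G u) (sym (δ≡0⇒≡ eq)) e))

  δ-lipschitz : ∀ {x y} → Edge G x y → ∀ u → δ x u ≤ suc (δ y u)
  δ-lipschitz e u = dist-≤ (step e (geodesic _ u))

  -- The second vertex of a geodesic to `u`; one edge lowers the distance by at most one.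
  closer : ∀ {x u k} → δ x u ≡ suc k → ∃ λ y → Edge G x y × δ y u ≡ k
  closer {x} {u} eq with step {w = y} e p ← subst (Walk G x u) eq (geodesic x u) =
    y , e , ≤-antisym (dist-≤ p) (≤-pred (≤-trans (≤-reflexive (sym eq)) (δ-lipschitz e u)))

  -- A path from x to y through vertices closer to u than x and y; acyclicity lets no edge,
  -- and no common neighbour farther from u, close it up.
  record Detour (u x y : Fin n) (k : ℕ) : Set where
    field
      inner        : List (Fin n)
      linked       : Linked (Edge G) (x ∷ inner ++ [ y ])
      inner-closer : All (λ w → δ w u < k) inner
      unique       : Unique inner
      nonempty     : 1 ≤ length inner

  -- Both ends are at distance `k` from `u` and the inner vertices are closer, so no end recurs
  -- inside.
  detour-unique : ∀ {u x y k} → δ x u ≡ k → δ y u ≡ k → x ≢ y → (inner : List (Fin n)) →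
    All (λ w → δ w u < k) inner → Unique inner → Unique (x ∷ inner ++ [ y ])
  detour-unique {u} {x} {y} refl δy x≢y inner cl uq =
    All.++⁺ (All.map (λ lt x≡w → <-irrefl (cong (λ z → δ z u) (sym x≡w)) lt) cl) (x≢y ∷ []) ∷
    Unique.++⁺ uq ([] ∷ []) λ where
      (w∈ , here refl) → <-irrefl δy (All.lookup cl w∈)

  -- Step from `x` and `y` towards `u` in parallel until the two vertices coincide, at `u` at the
  -- latest.
  detour : ∀ k {u x y} → δ x u ≡ k → δ y u ≡ k → x ≢ y → Detour u x y k
  detour zero δx δy x≢y = contradiction (trans (δ≡0⇒≡ δx) (sym (δ≡0⇒≡ δy))) x≢y
  detour (suc k) {u} {x} {y} δx δy x≢y with closer δx | closer δy
  ... | x′ , ex , δx′ | y′ , ey , δy′ with x′ ≟ y′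
  ... | yes refl = record
    { inner = [ x′ ] ; linked = ex ∷ edge-sym ey ∷ [-]
    ; inner-closer = s≤s (≤-reflexive δx′) ∷ [] ; unique = [] ∷ [] ; nonempty = s≤s z≤n }
  ... | no x′≢y′ = let open Detour (detour k δx′ δy′ x′≢y′) in record
    { inner = x′ ∷ inner ++ [ y′ ]
    ; linked = ex ∷ linked-∷ʳ (x′ ∷ inner) linked (edge-sym ey)
    ; inner-closer = s≤s (≤-reflexive δx′) ∷ All.++⁺ (All.map m≤n⇒m≤1+n inner-closer) (s≤s (≤-reflexive δy′) ∷ [])
    ; unique = detour-unique δx′ δy′ x′≢y′ inner inner-closer unique
    ; nonempty = s≤s z≤n }

  acyclic : ¬ HasCycle G
  acyclic = proj₂ (proj₂ tree)

  -- An edge between vertices equally far from `u` would close their detour to a cycle; this is the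
  -- bipartiteness of trees.
  edge⇒δ≢ : ∀ {x y} → Edge G x y → ∀ u → δ x u ≢ δ y u
  edge⇒δ≢ {x} {y} e u eq = acyclic (x , inner ++ [ y ] ,
      detour-unique refl (sym eq) x≢y inner inner-closer unique ,
      ≤-trans (+-monoˡ-≤ 1 nonempty) (≤-reflexive (sym (length-++ inner))) ,
      linked-∷ʳ (x ∷ inner) linked (edge-sym e))
    where
    x≢y : x ≢ y
    x≢y refl = edge-irrefl e
    open Detour (detour (δ x u) {u} refl (sym eq) x≢y)

  -- Rooted at `u`, a vertex has one parent: two of them, joined by a detour, would form a cycle
  -- with `z`, which lies farther from `u` than the whole detour.
  closer-unique : ∀ {u z x y} → Edge G z x → Edge G z y →
    δ z u ≡ suc (δ x u) → δ z u ≡ suc (δ y u) → x ≡ y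
  closer-unique {u} {z} {x} {y} ex ey δx δy with x ≟ y
  ... | yes eq = eq
  ... | no x≢y = contradiction
      (z , x ∷ inner ++ [ y ] ,
       (farther (≤-reflexive (sym δx)) ∷
         All.++⁺ (All.map (λ lt → farther (<-trans lt (≤-reflexive (sym δx)))) inner-closer)
                 (farther (≤-reflexive (sym δy)) ∷ [])) ∷
         detour-unique refl (sym eq) x≢y inner inner-closer unique ,
       s≤s (≤-trans (m≤n+m 1 (length inner)) (≤-reflexive (sym (length-++ inner)))) ,
       ex ∷ linked-∷ʳ (x ∷ inner) linked (edge-sym ey))
      acyclic
    where
    farther : ∀ {w} → δ w u < δ z u → z ≢ w
    farther lt refl = <-irrefl refl lt
    eq : δ x u ≡ δ y u
    eq = suc-injective (trans (sym δx) δy)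
    open Detour (detour (δ x u) {u} refl (sym eq) x≢y)

  edge-δ : ∀ {x y} → Edge G x y → ∀ u → δ y u ≡ suc (δ x u) ⊎ δ x u ≡ suc (δ y u)
  edge-δ {x} {y} e u with <-cmp (δ x u) (δ y u)
  ... | tri< lt _ _ = inj₁ (≤-antisym (δ-lipschitz (edge-sym e) u) lt)
  ... | tri≈ _ eq _ = contradiction eq (edge⇒δ≢ e u)
  ... | tri> _ _ gt = inj₂ (≤-antisym (δ-lipschitz e u) gt)

-- Diametral paths

-- Indexing by `ℕ`, with values past `d` left arbitrary, makes reversal the index change `d ∸ j`.
record DiametralPath (G : Graph n) : Set where
  field
    d     : ℕ
    p     : ℕ → Fin n
    edge  : ∀ {j} → j < d → Edge G (p j) (p (suc j))
    ends  : dist G (p 0) (p d) ≡ d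
    bound : ∀ u v → dist G u v ≤ d

module _ {G : Graph n} (tree : IsTree G) where
  open Tree G tree

  -- A geodesic between two vertices at maximal distance, found by maximising over the second end
  -- for each first end, then over the first.
  diametralPath : Fin n → DiametralPath G
  diametralPath o = record
    { d = δ a b ; p = vertexAt w ; edge = vertexAt-edge w
    ; ends = cong₂ δ (vertexAt-start w) (vertexAt-end w)
    ; bound = λ u v → ≤-trans (All.lookup (f[xs]≤f[argmax] {f = δ u} u (allFin n)) (∈-allFin v))
                              (All.lookup (f[xs]≤f[argmax] {f = λ u → δ u (far u)} o (allFin n)) (∈-allFin u)) }
    where
    far : Fin n → Fin n
    far u = argmax (δ u) u (allFin n)
    a = argmax (λ u → δ u (far u)) o (allFin n)
    b = far a
    w = geodesic a b

  -- Transfers facts about the direction towards `p d` to the direction towards `p 0`.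
  reversePath : DiametralPath G → DiametralPath G
  reversePath P = record
    { d = d ; p = λ j → p (d ∸ j)
    ; edge = λ {j} j<d → edge-sym (subst (λ i → Edge G (p (d ∸ suc j)) (p i)) (suc-∸ j<d)
               (edge (≤-trans (≤-reflexive (suc-∸ j<d)) (m∸n≤m d j))))
    ; ends = trans (δ-sym _ _) (trans (cong (λ i → δ (p i) (p d)) (n∸n≡0 d)) ends)
    ; bound = bound }
    where
    open DiametralPath P
    suc-∸ : ∀ {j} → j < d → suc (d ∸ suc j) ≡ d ∸ j
    suc-∸ j<d = sym (+-∸-assoc 1 j<d)

  module _ (P : DiametralPath G) where
    open DiametralPath P

    segment : ∀ m i → i + m ≤ d → Walk G (p i) (p (i + m)) m
    segment zero i _ = subst (λ j → Walk G (p i) (p j) 0) (sym (+-identityʳ i)) here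
    segment (suc m) i le = step (edge (≤-trans (m≤m+n (suc i) m) le′))
      (subst (λ j → Walk G (p (suc i)) (p j) m) (sym (+-suc i m)) (segment m (suc i) le′))
      where
      le′ : suc i + m ≤ d
      le′ = ≤-trans (≤-reflexive (sym (+-suc i m))) le

    -- A shortcut between `p i` and `p (i + m)` would, by the triangle inequality, bring `p 0` and
    -- `p d` closer than `d`.
    δ-path : ∀ i m → i + m ≤ d → δ (p i) (p (i + m)) ≡ m
    δ-path i m le = ≤-antisym (dist-≤ (segment m i le))
      (+-cancelʳ-≤ e m _ (+-cancelˡ-≤ i _ _ (begin
        i + (m + e)  ≡⟨ +-assoc i m e ⟨
        i + m + e    ≡⟨ i+m+e≡d ⟩
        d            ≡⟨ ends ⟨
        δ (p 0) (p d)  ≤⟨ δ-triangle _ (p i) _ ⟩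
        δ (p 0) (p i) + δ (p i) (p d) ≤⟨ +-mono-≤ (dist-≤ (segment i 0 (m+n≤o⇒m≤o i le))) (δ-triangle _ (p (i + m)) _) ⟩
        i + (x + δ (p (i + m)) (p d)) ≤⟨ +-monoʳ-≤ i (+-monoʳ-≤ x tail) ⟩
        i + (x + e) ∎)))
      where
      open ≤-Reasoning
      e = d ∸ (i + m)
      x = δ (p i) (p (i + m))
      i+m+e≡d : i + m + e ≡ d
      i+m+e≡d = m+[n∸m]≡n le
      tail : δ (p (i + m)) (p d) ≤ e
      tail = subst (λ j → δ (p (i + m)) (p j) ≤ e) i+m+e≡d (dist-≤ (segment e (i + m) (≤-reflexive i+m+e≡d)))

    -- A distance that starts to grow along the path keeps growing: a later local maximum
    -- would have two neighbours closer to u.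
    rising : ∀ u m i → suc i + m ≤ d → δ (p (suc i)) u ≡ suc (δ (p i) u) →
             δ (p (suc i + m)) u ≡ suc m + δ (p i) u
    rising u zero i le up = trans (cong (λ j → δ (p (suc j)) u) (+-identityʳ i)) up
    rising u (suc m) i le up = begin
      δ (p (suc i + suc m)) u    ≡⟨ cong (λ j → δ (p (suc j)) u) (+-suc i m) ⟩
      δ (p (suc (suc i) + m)) u  ≡⟨ rising u m (suc i) le′ next ⟩
      suc m + δ (p (suc i)) u    ≡⟨ cong (suc m +_) up ⟩
      suc m + suc (δ (p i) u)    ≡⟨ +-suc (suc m) _ ⟩
      suc (suc m) + δ (p i) u    ∎
      where
      open ≡-Reasoning
      le′ : suc (suc i) + m ≤ d
      le′ = ≤-trans (≤-reflexive (cong suc (sym (+-suc i m)))) le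
      i+2≤d : suc (suc i) ≤ d
      i+2≤d = m+n≤o⇒m≤o _ le′
      next : δ (p (suc (suc i))) u ≡ suc (δ (p (suc i)) u)
      next with edge-δ (edge i+2≤d) u
      ... | inj₁ eq = eq
      -- The two closer neighbours of `p (suc i)` would coincide, but `p i` and `p (i + 2)` are at
      -- distance 2.
      ... | inj₂ down = contradiction
            (trans (sym (δ-refl (p i))) (trans (cong (δ (p i))
              (trans (closer-unique (edge-sym (edge (<⇒≤ i+2≤d))) (edge i+2≤d) up down) (cong p (+-comm 2 i))))
              (δ-path i 2 (≤-trans (≤-reflexive (+-comm i 2)) i+2≤d))))
            λ ()

  module _ (P : DiametralPath G) where
    open DiametralPath P

    -- If the distance to `u` grows after `p i`, it grows up to `p d`, gaining `d ∸ i` without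
    -- exceeding `d`, so it is at most `i` at `p i`. Otherwise it grows from `p i` back to `p 0`,
    -- and the bound is `d ∸ i`.
    δ-path-≤ : ∀ {i} → i ≤ d → ∀ u → δ u (p i) ≤ i ⊔ (d ∸ i)
    δ-path-≤ {i} i≤d u with m≤n⇒m<n∨m≡n i≤d
    ... | inj₂ refl = ≤-trans (bound u (p i)) (m≤m⊔n d (d ∸ d))
    ... | inj₁ i<d with edge-δ (edge i<d) u
    ... | inj₁ up = ≤-trans (≤-reflexive (δ-sym u (p i))) (≤-trans (+-cancelˡ-≤ (d ∸ i) _ _ (begin
        d ∸ i + δ (p i) u           ≡⟨ cong (_+ δ (p i) u) (+-∸-assoc 1 i<d) ⟩
        suc (d ∸ suc i) + δ (p i) u ≡⟨ rising P u (d ∸ suc i) i (≤-reflexive (m+[n∸m]≡n i<d)) up ⟨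
        δ (p (suc i + (d ∸ suc i))) u ≤⟨ bound _ u ⟩
        d                           ≡⟨ m∸n+n≡m i≤d ⟨
        d ∸ i + i                   ∎)) (m≤m⊔n i _))
      where open ≤-Reasoning
    ... | inj₂ down = ≤-trans (≤-reflexive (δ-sym u (p i))) (≤-trans (m+n≤o⇒m≤o∸n (δ (p i) u) (begin
        δ (p i) u + i                  ≡⟨ +-comm _ i ⟩
        i + δ (p i) u                  ≡⟨ cong (i +_) down ⟩
        i + suc (δ (p (suc i)) u)      ≡⟨ +-suc i _ ⟩
        suc i + δ (p (suc i)) u        ≡⟨ cong (λ j → suc i + δ (p j) u) (m∸[m∸n]≡n i<d) ⟨
        suc i + δ (p (d ∸ i′)) u       ≡⟨ rising (reversePath P) u i i′ (≤-reflexive i′+i) down′ ⟨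
        δ (p (d ∸ (suc i′ + i))) u     ≤⟨ bound _ u ⟩
        d                              ∎)) (m≤n⊔m i _))
      where
      open ≤-Reasoning
      -- In the reversed path `p (suc i)` has index `i′`, `p i` has index `suc i′`, and `p 0` has
      -- index `d`.
      i′ = d ∸ suc i
      suc-i′ : suc i′ ≡ d ∸ i
      suc-i′ = sym (+-∸-assoc 1 i<d)
      i′+i : suc i′ + i ≡ d
      i′+i = trans (cong (_+ i) suc-i′) (m∸n+n≡m i≤d)
      down′ : δ (p (d ∸ suc i′)) u ≡ suc (δ (p (d ∸ i′)) u)
      down′ = trans (cong (λ j → δ (p j) u) (trans (cong (d ∸_) suc-i′) (m∸[m∸n]≡n i≤d)))
                    (trans down (cong (λ j → suc (δ (p j) u)) (sym (m∸[m∸n]≡n i<d))))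

    path-injective : ∀ {i j} → i < j → j ≤ d → p i ≢ p j
    path-injective {i} {j} i<j j≤d eq = <-irrefl (begin
        0                         ≡⟨ δ-refl (p i) ⟨
        δ (p i) (p i)             ≡⟨ cong (δ (p i)) eq ⟩
        δ (p i) (p j)             ≡⟨ cong (δ (p i) ∘ p) i+m≡j ⟨
        δ (p i) (p (i + (j ∸ i))) ≡⟨ δ-path P i (j ∸ i) (≤-trans (≤-reflexive i+m≡j) j≤d) ⟩
        j ∸ i                     ∎) (m<n⇒0<n∸m i<j)
      where
      open ≡-Reasoning
      i+m≡j = m+[n∸m]≡n (<⇒≤ i<j)

    onPath : List (Fin n)
    onPath = applyUpTo p (suc d)

    offPath : List (Fin n)
    offPath = complement onPath

    r : ℕ
    r = length offPath

    unique-onPath : Unique onPath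
    unique-onPath = Unique.applyUpTo⁺₁ p (suc d) λ i<j j<n → path-injective i<j (≤-pred j<n)

    order-≡ : suc d + r ≡ n
    order-≡ = trans (cong (_+ r) (sym (length-applyUpTo p (suc d)))) (length-complement onPath unique-onPath)

    -- A geodesic has no chords.
    adjacent-on-path : ∀ {i j} → i ≤ j → j ≤ d → Edge G (p i) (p j) → j ≡ suc i
    adjacent-on-path {i} {j} i≤j j≤d e = trans (sym i+m≡j) (trans (cong (i +_) (begin
        j ∸ i                     ≡⟨ δ-path P i (j ∸ i) (≤-trans (≤-reflexive i+m≡j) j≤d) ⟨
        δ (p i) (p (i + (j ∸ i))) ≡⟨ cong (δ (p i) ∘ p) i+m≡j ⟩
        δ (p i) (p j)             ≡⟨ δ-edge e ⟩
        1                         ∎)) (+-comm i 1))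
      where
      open ≡-Reasoning
      i+m≡j = m+[n∸m]≡n i≤j

    predecessor : ∀ {i k} → suc k ≤ d → i ≤ suc k → Edge G (p (suc k)) (p i) → p i ≡ p k
    predecessor k<d i≤k e = cong p (sym (suc-injective (adjacent-on-path i≤k k<d (edge-sym e))))

    -- After `p i`, at distance 1 from `c`, the distance either keeps growing and is at least 2 at
    -- `p j`, or drops to 0, which puts `c` on the path.
    offPath-one-neighbour : ∀ {c i j} → (∀ {k} → k ≤ d → c ≢ p k) → i < j → j ≤ d →
                            Edge G c (p i) → ¬ Edge G c (p j)
    offPath-one-neighbour {c} {i} {j} off i<j j≤d ei ej with edge-δ (edge (<-≤-trans i<j j≤d)) c
    ... | inj₁ up = contradiction (begin
        1                             ≡⟨ δ-edge (edge-sym ej) ⟨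
        δ (p j) c                     ≡⟨ cong (λ k → δ (p k) c) i+m≡j ⟨
        δ (p (suc i + (j ∸ suc i))) c ≡⟨ rising P c (j ∸ suc i) i (≤-trans (≤-reflexive i+m≡j) j≤d) up ⟩
        suc (j ∸ suc i) + δ (p i) c   ≡⟨ cong (suc (j ∸ suc i) +_) (δ-edge (edge-sym ei)) ⟩
        suc (j ∸ suc i) + 1           ≡⟨ +-comm _ 1 ⟩
        suc (suc (j ∸ suc i))         ∎) λ ()
      where
      open ≡-Reasoning
      i+m≡j = m+[n∸m]≡n i<j
    ... | inj₂ down = off (≤-trans i<j j≤d)
            (sym (δ≡0⇒≡ (suc-injective (trans (sym down) (δ-edge (edge-sym ei))))))

    -- A degree of r + 2 is only reached inside the path, by a vertex adjacent to everything off it.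
    data Attachment (c : Fin n) : Set where
      small : degree G c < 2 + r → Attachment c
      hub   : ∀ k → 0 < k → k < d → c ≡ p k → (∀ {w} → w ∈ offPath → Edge G (p k) w) →
              degree G c ≡ 2 + r → Attachment c

    module _ (c : Fin n) where

      -- `Q` collects the vertices of the path that may be adjacent to `c`.
      degree-≤ : ∀ Q → neighbours G c ⊆ Q ++ offPath → degree G c ≤ length Q + r
      degree-≤ Q sub = begin
        degree G c              ≡⟨ length-neighbours G c ⟨
        length (neighbours G c) ≤⟨ unique-⊆⇒length≤ (unique-neighbours G c) sub ⟩
        length (Q ++ offPath)   ≡⟨ length-++ Q ⟩
        length Q + r            ∎
        where open ≤-Reasoning

      neighbours-⊆ : ∀ Q → (∀ {i} → i ≤ d → Edge G c (p i) → p i ∈ Q) → neighbours G c ⊆ Q ++ offPath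
      neighbours-⊆ Q h {w} w∈ with Any.any? (w ≟_) onPath
      ... | no w∉ = ∈-++⁺ʳ Q (∈-complement⁺ w∉)
      ... | yes w∈P with ∈-applyUpTo⁻ p w∈P
      ... | i , s≤s i≤d , refl = ∈-++⁺ˡ (h i≤d (∈-neighbours⁻ G {v = c} w∈))

      attachment-on : ∀ k → k ≤ d → c ≡ p k → Attachment c
      attachment-on zero _ refl = small (s≤s (degree-≤ [ p 1 ] (neighbours-⊆ [ p 1 ] λ i≤d e →
        here (cong p (adjacent-on-path z≤n i≤d e)))))
      attachment-on (suc k) k<d refl with m≤n⇒m<n∨m≡n k<d
      ... | inj₂ eq = small (s≤s (degree-≤ [ p k ] (neighbours-⊆ [ p k ] λ i≤d e →
              here (predecessor k<d (≤-trans i≤d (≤-reflexive (sym eq))) e))))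
      ... | inj₁ k+1<d =
        [ small
        , (λ eq → hub (suc k) (s≤s z≤n) k+1<d refl (λ w∈ → ∈-neighbours⁻ G (sup eq (there (there w∈)))) eq) ]′
        (m≤n⇒m<n∨m≡n (degree-≤ Q sub))
        where
        Q = p k ∷ p (suc (suc k)) ∷ []
        sub : neighbours G c ⊆ Q ++ offPath
        sub = neighbours-⊆ Q λ {i} i≤d e →
          [ (λ i≤k → here (predecessor k<d i≤k e))
          , (λ k≤i → there (here (cong p (adjacent-on-path k≤i i≤d e)))) ]′ (≤-total i (suc k))
        -- With degree `2 + r` the neighbours are as many as the entries of the list that contains
        -- them, so they fill it, and all of `offPath` is adjacent to `c`.
        sup : degree G c ≡ 2 + r → Q ++ offPath ⊆ neighbours G c
        sup eq = unique-⊆-length≥⇒⊇ (unique-neighbours G c) sub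
                (≤-reflexive (trans (sym eq) (sym (length-neighbours G c))))

      -- Such a vertex has at most one neighbour on the path, so its degree is at most `1 + r`.
      attachment-off : (∀ {k} → k ≤ d → c ≢ p k) → Attachment c
      attachment-off off with Any.any? (λ v → G c v Bool.≟ true) onPath
      ... | no none = small (s≤s (m≤n⇒m≤1+n (degree-≤ [] (neighbours-⊆ [] λ i≤d e →
              contradiction (Any.map (λ where refl → e) (∈-applyUpTo⁺ p (s≤s i≤d))) none))))
      ... | yes some with find some
      ... | v , v∈ , ev with ∈-applyUpTo⁻ p v∈
      ... | j , s≤s j≤d , refl = small (s≤s (degree-≤ [ p j ] (neighbours-⊆ [ p j ] only)))
        where
        only : ∀ {i} → i ≤ d → Edge G c (p i) → p i ∈ [ p j ]
        only {i} i≤d e with <-cmp i j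
        ... | tri< i<j _ _ = contradiction ev (offPath-one-neighbour off i<j j≤d e)
        ... | tri≈ _ refl _ = here refl
        ... | tri> _ _ j<i = contradiction e (offPath-one-neighbour off j<i i≤d ev)

      attachment : Attachment c
      attachment with Any.any? (c ≟_) onPath
      ... | yes c∈ = let k , k<1+d , eq = ∈-applyUpTo⁻ p c∈ in attachment-on k (≤-pred k<1+d) eq
      ... | no c∉ = attachment-off λ k≤d eq → c∉ (subst (_∈ onPath) (sym eq) (∈-applyUpTo⁺ p (s≤s k≤d)))

sum-applyUpTo-mono : ∀ {f g : ℕ → ℕ} n → (∀ {j} → j < n → f j ≤ g j) →
                     sum (applyUpTo f n) ≤ sum (applyUpTo g n)
sum-applyUpTo-mono zero _ = z≤n
sum-applyUpTo-mono (suc n) h = +-mono-≤ (h (s≤s z≤n)) (sum-applyUpTo-mono n (h ∘ s≤s))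

-- Sum of the eccentricities of the vertices of a path of length d.
pathSum : ℕ → ℕ
pathSum d = sum (applyUpTo (λ j → j ⊔ (d ∸ j)) (suc d))

-- No earlier term decreases when the path grows, and the new last term is `suc d`.
pathSum-suc : ∀ d → pathSum d + suc d ≤ pathSum (suc d)
pathSum-suc d = begin
  pathSum d + suc d          ≤⟨ +-mono-≤ (sum-applyUpTo-mono (suc d) (λ {j} _ → ⊔-monoʳ-≤ j (∸-monoˡ-≤ j (n≤1+n d))))
                                         (≤-trans (m≤m⊔n (suc d) (d ∸ d)) (≤-reflexive (sym (+-identityʳ _)))) ⟩
  sum (applyUpTo b (suc d)) + sum [ b (suc d) ] ≡⟨ sum-++ (applyUpTo b (suc d)) _ ⟨
  sum (applyUpTo b (suc d) ++ [ b (suc d) ]) ≡⟨ cong sum (applyUpTo-∷ʳ b (suc d)) ⟩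
  pathSum (suc d)            ∎
  where
  open ≤-Reasoning
  b : ℕ → ℕ
  b j = j ⊔ (suc d ∸ j)

-- Each added vertex brings at least `d + 1`. The part `e * d` will pay for `e` vertices moved from
-- off the path onto it; the surplus `e` makes the comparison strict.
pathSum-+ : ∀ d e → pathSum d + e * d + e ≤ pathSum (e + d)
pathSum-+ d zero = ≤-reflexive (trans (+-identityʳ _) (+-identityʳ _))
pathSum-+ d (suc e) = begin
  pathSum d + (d + e * d) + suc e   ≡⟨ rearrange (pathSum d) d (e * d) e ⟩
  (pathSum d + e * d + e) + suc d   ≤⟨ +-mono-≤ (pathSum-+ d e) (s≤s (m≤n+m d e)) ⟩
  pathSum (e + d) + suc (e + d)     ≤⟨ pathSum-suc (e + d) ⟩
  pathSum (suc e + d)               ∎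
  where
  open ≤-Reasoning
  rearrange : ∀ a b c x → a + (b + c) + suc x ≡ (a + c + x) + suc b
  rearrange = solve-∀

-- The broom

-- An inductive form of `broomAdj`, oriented away from the centre; adjacency is the union of the two
-- orientations.
data BroomEdge (Δ : ℕ) : ℕ → ℕ → Set where
  spoke  : ∀ {j} → suc j ≤ Δ → BroomEdge Δ 0 (suc j)
  handle : ∀ {i} → Δ ≤ i → BroomEdge Δ i (suc i)

broomAdj⁻ : ∀ Δ i j → T (broomAdj Δ i j) → BroomEdge Δ i j ⊎ BroomEdge Δ j i
broomAdj⁻ Δ i j t with T-∨ .to t
... | inj₁ t₁ with T-∧ .to t₁
...   | i≡0 , t₂ with T-∧ .to t₂
...     | 1≤j , j≤Δ with refl ← ≡ᵇ⇒≡ i 0 i≡0 | s≤s _ ← ≤ᵇ⇒≤ 1 j 1≤j = inj₁ (spoke (≤ᵇ⇒≤ j Δ j≤Δ))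
broomAdj⁻ Δ i j t | inj₂ t₁ with T-∨ .to t₁
... | inj₁ t₂ with T-∧ .to t₂
...   | j≡0 , t₃ with T-∧ .to t₃
...     | 1≤i , i≤Δ with refl ← ≡ᵇ⇒≡ j 0 j≡0 | s≤s _ ← ≤ᵇ⇒≤ 1 i 1≤i = inj₂ (spoke (≤ᵇ⇒≤ i Δ i≤Δ))
broomAdj⁻ Δ i j t | inj₂ t₁ | inj₂ t₂ with T-∨ {(Δ ≤ᵇ i) ∧ (j ≡ᵇ suc i)} .to t₂
... | inj₁ t₃ with T-∧ {Δ ≤ᵇ i} .to t₃
...   | Δ≤i , j≡ with refl ← ≡ᵇ⇒≡ j (suc i) j≡ = inj₁ (handle (≤ᵇ⇒≤ Δ i Δ≤i))
broomAdj⁻ Δ i j t | inj₂ t₁ | inj₂ t₂ | inj₂ t₃ with T-∧ {Δ ≤ᵇ j} .to t₃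
...   | Δ≤j , i≡ with refl ← ≡ᵇ⇒≡ i (suc j) i≡ = inj₂ (handle (≤ᵇ⇒≤ Δ j Δ≤j))

broomAdj⁺ : ∀ Δ i j → BroomEdge Δ i j ⊎ BroomEdge Δ j i → T (broomAdj Δ i j)
broomAdj⁺ Δ i j (inj₁ b) = go i j b refl refl
  where
  -- The index tested by `≡ᵇ` stays a variable with an equation, so that its test does not compute
  -- away.
  go : ∀ i j {i′ j′} → BroomEdge Δ i′ j′ → i ≡ i′ → j ≡ j′ → T (broomAdj Δ i j)
  go i j (spoke le) i≡ refl = T-∨ .from (inj₁ (T-∧ .from (≡⇒≡ᵇ i 0 i≡ , ≤⇒≤ᵇ le)))
  go i j (handle {i′} le) refl j≡ =
    T-∨ {(i ≡ᵇ 0) ∧ (1 ≤ᵇ j) ∧ (j ≤ᵇ Δ)} .from (inj₂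
      (T-∨ {(j ≡ᵇ 0) ∧ (1 ≤ᵇ i) ∧ (i ≤ᵇ Δ)} .from (inj₂ (T-∨ .from (inj₁
      (T-∧ .from (≤⇒≤ᵇ le , ≡⇒≡ᵇ j (suc i) j≡)))))))
broomAdj⁺ Δ i j (inj₂ b) = go i j b refl refl
  where
  go : ∀ i j {j′ i′} → BroomEdge Δ j′ i′ → i ≡ i′ → j ≡ j′ → T (broomAdj Δ i j)
  go i j (spoke le) refl j≡ =
    T-∨ {(i ≡ᵇ 0) ∧ (1 ≤ᵇ j) ∧ (j ≤ᵇ Δ)} .from (inj₂ (T-∨ .from (inj₁ (T-∧ .from (≡⇒≡ᵇ j 0 j≡ , ≤⇒≤ᵇ le)))))
  go i j (handle le) i≡ refl =
    T-∨ {(i ≡ᵇ 0) ∧ (1 ≤ᵇ j) ∧ (j ≤ᵇ Δ)} .from (inj₂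
      (T-∨ {(j ≡ᵇ 0) ∧ (1 ≤ᵇ i) ∧ (i ≤ᵇ Δ)} .from (inj₂
      (T-∨ {(Δ ≤ᵇ i) ∧ (j ≡ᵇ suc i)} .from (inj₂ (T-∧ .from (≤⇒≤ᵇ le , ≡⇒≡ᵇ i (suc j) i≡)))))))

-- Position along the longest path 1 – 0 – Δ – (Δ+1) – … – (n-1) of the broom with Δ = 2 + s,
-- all leaves being put at position 0.
tailPosition : ℕ → ℕ → ℕ
tailPosition zero i = 2 + i
tailPosition (suc m) zero = 0
tailPosition (suc m) (suc i) = tailPosition m i

position : ℕ → ℕ → ℕ
position s zero = 1
position s (suc i) = tailPosition (suc s) i

-- Leaves sit at 0 and the first vertex of the handle at 2, each one step from the centre at 1.
tailPosition-spoke : ∀ m {i} → i ≤ m → ∣ 1 - tailPosition m i ∣ ≤ 1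
tailPosition-spoke zero z≤n = ≤-refl
tailPosition-spoke (suc m) {zero} _ = ≤-refl
tailPosition-spoke (suc m) {suc i} (s≤s le) = tailPosition-spoke m le

tailPosition-handle : ∀ m {i} → m ≤ i → ∣ tailPosition m i - tailPosition m (suc i) ∣ ≤ 1
tailPosition-handle zero {i} _ = ≤-reflexive (trans (∣-∣-comm i (suc i)) (∣suc-∣ i))
  where
  ∣suc-∣ : ∀ i → ∣ suc i - i ∣ ≡ 1
  ∣suc-∣ zero = refl
  ∣suc-∣ (suc i) = ∣suc-∣ i
tailPosition-handle (suc m) {suc i} (s≤s le) = tailPosition-handle m le

tailPosition-≤ : ∀ m i → tailPosition m i ≤ 2 + i
tailPosition-≤ zero i = ≤-refl
tailPosition-≤ (suc m) zero = z≤n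
tailPosition-≤ (suc m) (suc i) = m≤n⇒m≤1+n (tailPosition-≤ m i)

tailPosition-+ : ∀ m k → tailPosition m (m + k) ≡ 2 + k
tailPosition-+ zero k = refl
tailPosition-+ (suc m) k = tailPosition-+ m k

-- This makes `position` 1-Lipschitz, so that its differences bound distances in the broom from
-- below.
position-edge : ∀ {s i j} → BroomEdge (2 + s) i j → ∣ position s i - position s j ∣ ≤ 1
position-edge {s} (spoke (s≤s le)) = tailPosition-spoke (suc s) le
position-edge {s} (handle {suc i} (s≤s le)) = tailPosition-handle (suc s) le

sum-tailPosition : ∀ (b : ℕ → ℕ) m k →
  sum (applyUpTo (b ∘ tailPosition m) (m + k)) ≡ m * b 0 + sum (applyUpTo (b ∘ (2 +_)) k)
sum-tailPosition b zero k = refl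
sum-tailPosition b (suc m) k = trans (cong (b 0 +_) (sum-tailPosition b m k)) (sym (+-assoc (b 0) _ _))

tabulate-toℕ : ∀ {A : Set} (f : ℕ → A) n → tabulate {n = n} (f ∘ toℕ) ≡ applyUpTo f n
tabulate-toℕ f zero = refl
tabulate-toℕ f (suc n) = cong (f 0 ∷_) (tabulate-toℕ (f ∘ suc) n)

map-toℕ-allFin : ∀ {A : Set} (f : ℕ → A) n → map (f ∘ toℕ) (allFin n) ≡ applyUpTo f n
map-toℕ-allFin f n = trans (map-tabulate id (f ∘ toℕ)) (tabulate-toℕ f n)

eccentricitySum : Graph n → ℕ
eccentricitySum {n} G = sum (map (eccentricity G) (allFin n))

module _ (s m : ℕ) where
  private
    -- With `Δ = 2 + s` these satisfy `D = N − Δ + 1`.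
    N D : ℕ
    N = suc (suc s + suc m)
    D = 2 + m
    B : Graph N
    B = broom N (2 + s)

  position-dist : ∀ (u v : Fin N) → ∣ position s (toℕ u) - position s (toℕ v) ∣ ≤ dist B u v
  position-dist = dist-lipschitz (position s ∘ toℕ) (λ {u} {v} → lip {u} {v}) λ v → position-≤ (toℕ v) (toℕ<n v)
    where
    lip : ∀ {u v} → Edge B u v → ∣ position s (toℕ u) - position s (toℕ v) ∣ ≤ 1
    lip {u} {v} e with broomAdj⁻ (2 + s) (toℕ u) (toℕ v) (T-≡ .from e)
    ... | inj₁ b = position-edge b
    ... | inj₂ b = ≤-trans (≤-reflexive (∣-∣-comm (position s (toℕ u)) _)) (position-edge b)
    position-≤ : ∀ i → i < N → position s i ≤ N
    position-≤ zero _ = s≤s z≤n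
    position-≤ (suc i) i<N = ≤-trans (tailPosition-≤ (suc s) i) i<N

  -- The two terms are bounds for the distances to the leaf 1, at position 0, and to the last
  -- vertex, at position `D`.
  position≤eccentricity : ∀ v → position s (toℕ v) ⊔ (D ∸ position s (toℕ v)) ≤ eccentricity B v
  position≤eccentricity v = ⊔-lub
    (≤-trans (position-dist (fsuc fzero) v) (dist≤eccentricity (fsuc fzero) v))
    (≤-trans (m∸n≤∣m-n∣ D x)
      (≤-trans (subst (λ y → ∣ y - x ∣ ≤ dist B end v) end-position (position-dist end v)) (dist≤eccentricity end v)))
    where
    x = position s (toℕ v)
    end<N : suc (suc s + m) < N
    end<N = s≤s (s≤s (≤-reflexive (sym (+-suc s m))))
    end : Fin N
    end = fromℕ< end<N
    end-position : position s (toℕ end) ≡ D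
    end-position = trans (cong (position s) (toℕ-fromℕ< end<N)) (tailPosition-+ (suc s) m)

  -- The `suc s` leaves at position 0 count `D` each; one of them together with all other vertices
  -- accounts for `pathSum D`.
  broom-eccentricitySum : s * D + pathSum D ≤ eccentricitySum B
  broom-eccentricitySum = begin
    s * D + (D + (b 1 + t))         ≡⟨ rearrange (s * D) D (b 1) t ⟩
    b 1 + (suc s * D + t)           ≡⟨ cong (b 1 +_) (sum-tailPosition b (suc s) (suc m)) ⟨
    sum (applyUpTo (b ∘ position s) N) ≡⟨ cong sum (map-toℕ-allFin (b ∘ position s) N) ⟨
    sum (map (b ∘ position s ∘ toℕ) (allFin N)) ≤⟨ sum-map-mono (allFin N) (λ {v} _ → position≤eccentricity v) ⟩
    eccentricitySum B               ∎
    where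
    open ≤-Reasoning
    b : ℕ → ℕ
    b x = x ⊔ (D ∸ x)
    t = sum (applyUpTo (b ∘ (2 +_)) (suc m))
    rearrange : ∀ a c x t → a + (c + (x + t)) ≡ x + ((c + a) + t)
    rearrange = solve-∀

-- Recognising the broom

-- Serves to number the vertices of a broom: leaves first, then the handle.
spread : ∀ {A : Set} → (ℕ → A) → List A → ℕ → A
spread f [] i = f i
spread f (x ∷ xs) zero = x
spread f (x ∷ xs) (suc i) = spread f xs i

module _ {A : Set} (f : ℕ → A) where

  spread-∈ : ∀ xs {i} → i < length xs → spread f xs i ∈ xs
  spread-∈ (x ∷ xs) {zero} _ = here refl
  spread-∈ (x ∷ xs) {suc i} (s≤s lt) = there (spread-∈ xs lt)

  spread-+ : ∀ xs k → spread f xs (length xs + k) ≡ f k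
  spread-+ [] k = refl
  spread-+ (x ∷ xs) k = spread-+ xs k

  spread-surjective : ∀ {xs x} → x ∈ xs → ∃ λ i → i < length xs × spread f xs i ≡ x
  spread-surjective (here refl) = 0 , s≤s z≤n , refl
  spread-surjective (there x∈) = let i , lt , eq = spread-surjective x∈ in suc i , s≤s lt , eq

-- A section `g` of `h` is injective, hence surjective on a finite set, hence a two-sided inverse.
surjective⇒permutation : (h : Fin n → Fin n) → (∀ x → ∃ λ i → h i ≡ x) →
  Σ (Permutation′ n) λ σ → (∀ x → h (σ ⟨$⟩ʳ x) ≡ x) × (∀ i → σ ⟨$⟩ʳ (h i) ≡ i)
surjective⇒permutation {n} h surj = permutation g h gh hg , hg , gh
  where
  g : Fin n → Fin n
  g x = proj₁ (surj x)
  hg : ∀ x → h (g x) ≡ x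
  hg x = proj₂ (surj x)
  gh : ∀ i → g (h i) ≡ i
  gh i with injective⇒surjective g (λ {x} {y} eq → trans (sym (hg x)) (trans (cong h eq) (hg y))) i
  ... | x , refl = cong g (hg x)

true-ext : ∀ {a b} → (a ≡ true → b ≡ true) → (b ≡ true → a ≡ true) → a ≡ b
true-ext {true} f _ = sym (f refl)
true-ext {false} {true} _ g = g refl
true-ext {false} {false} _ _ = refl

module _ {G : Graph n} (tree : IsTree G) (P : DiametralPath G) where
  open Tree G tree
  open DiametralPath P

  module _ (2≤d : 2 ≤ d) (attached : ∀ {w} → w ∈ offPath tree P → Edge G (p 1) w) where
    private
      -- These are the neighbours of `p 1` other than `p 2`; so the degree of the broom is `suc ℓ`.
      leaves : List (Fin n)
      leaves = p 0 ∷ offPath tree P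

      ℓ : ℕ
      ℓ = length leaves

      -- Follows the numbering of `broom`: centre `p 1`, then the leaves, then the handle, which
      -- starts with `p 2` at index `suc ℓ`.
      vertex : ℕ → Fin n
      vertex zero = p 1
      vertex (suc i) = spread (p ∘ (2 +_)) leaves i

      order : n ≡ d + ℓ
      order = sym (trans (+-suc d _) (order-≡ tree P))

      -- The kinds of indices in this numbering; `tail {k}` belongs to `p (2 + k)`.
      data Label : ℕ → Set where
        centre : Label 0
        leaf   : ∀ {i} → i < ℓ → Label (suc i)
        tail   : ∀ {k} → 2 + k ≤ d → Label (suc (ℓ + k))

      label : ∀ j → j < n → Label j
      label zero _ = centre
      label (suc i) lt with i <? ℓ
      ... | yes i<ℓ = leaf i<ℓ
      ... | no i≮ℓ = subst (Label ∘ suc) (m+[n∸m]≡n (≮⇒≥ i≮ℓ)) (tail (+-cancelˡ-≤ ℓ _ _ (begin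
          ℓ + (2 + (i ∸ ℓ))  ≡⟨ rearrange ℓ (i ∸ ℓ) ⟩
          2 + (ℓ + (i ∸ ℓ))  ≡⟨ cong (2 +_) (m+[n∸m]≡n (≮⇒≥ i≮ℓ)) ⟩
          2 + i              ≤⟨ lt ⟩
          n                  ≡⟨ order ⟩
          d + ℓ              ≡⟨ +-comm d ℓ ⟩
          ℓ + d              ∎)))
        where
        open ≤-Reasoning
        rearrange : ∀ a b → a + (2 + b) ≡ 2 + (a + b)
        rearrange = solve-∀

      leaf<n : ∀ {i} → i < ℓ → suc i < n
      leaf<n i<ℓ = ≤-trans (+-mono-≤ (<⇒≤ 2≤d) i<ℓ) (≤-reflexive (sym order))

      tail<n : ∀ {k} → 2 + k ≤ d → suc (ℓ + k) < n
      tail<n {k} le = begin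
        2 + (ℓ + k)  ≡⟨ rearrange ℓ k ⟩
        2 + k + ℓ    ≤⟨ +-monoˡ-≤ ℓ le ⟩
        d + ℓ        ≡⟨ order ⟨
        n            ∎
        where
        open ≤-Reasoning
        rearrange : ∀ a b → 2 + (a + b) ≡ 2 + b + a
        rearrange = solve-∀

      vertex-tail : ∀ k → vertex (suc (ℓ + k)) ≡ p (2 + k)
      vertex-tail = spread-+ (p ∘ (2 +_)) leaves

      vertex-surjective : ∀ x → ∃ λ i → i < n × vertex i ≡ x
      vertex-surjective x with Any.any? (x ≟_) (onPath tree P)
      ... | no x∉ = let i , lt , eq = spread-surjective (p ∘ (2 +_)) {leaves} (there (∈-complement⁺ x∉))
                    in suc i , leaf<n lt , eq
      ... | yes x∈ with ∈-applyUpTo⁻ p x∈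
      ... | zero , _ , eq = 1 , leaf<n (s≤s z≤n) , sym eq
      ... | suc zero , _ , eq = 0 , <-trans (s≤s z≤n) (leaf<n (s≤s z≤n)) , sym eq
      ... | suc (suc k) , s≤s le , eq = suc (ℓ + k) , tail<n le , trans (vertex-tail k) (sym eq)

      H : Fin n → Fin n
      H = vertex ∘ toℕ

      numbering : Σ (Permutation′ n) λ σ → (∀ x → H (σ ⟨$⟩ʳ x) ≡ x) × (∀ i → σ ⟨$⟩ʳ (H i) ≡ i)
      numbering = surjective⇒permutation H λ x → let i , i<n , eq = vertex-surjective x in
        fromℕ< i<n , trans (cong vertex (toℕ-fromℕ< i<n)) eq

      σ : Permutation′ n
      σ = proj₁ numbering

      -- Comes from surjectivity by finiteness: `σ` is also a left inverse of `H`.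
      vertex-injective : ∀ {i j} → i < n → j < n → vertex i ≡ vertex j → i ≡ j
      vertex-injective {i} {j} i<n j<n eq =
        trans (sym (toℕ-fromℕ< i<n)) (trans (cong toℕ (trans (sym (σH (fromℕ< i<n)))
        (trans (cong (σ ⟨$⟩ʳ_) (trans (cong vertex (toℕ-fromℕ< i<n)) (trans eq (cong vertex (sym (toℕ-fromℕ< j<n))))))
          (σH (fromℕ< j<n))))) (toℕ-fromℕ< j<n))
        where
        σH = proj₂ (proj₂ numbering)

      leaf-edge : ∀ {i} → i < ℓ → Edge G (p 1) (vertex (suc i))
      leaf-edge i<ℓ with spread-∈ (p ∘ (2 +_)) leaves i<ℓ
      ... | here eq = subst (Edge G (p 1)) (sym eq) (edge-sym (edge (<⇒≤ 2≤d)))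
      ... | there w∈ = attached w∈

      tail-edge : ∀ {k} → 3 + k ≤ d → Edge G (vertex (suc (ℓ + k))) (vertex (suc (ℓ + suc k)))
      tail-edge {k} le = subst₂ (Edge G) (sym (vertex-tail k)) (sym (vertex-tail (suc k))) (edge le)

      broom⇒edge : ∀ {i j} → j < n → BroomEdge (suc ℓ) i j → Edge G (vertex i) (vertex j)
      broom⇒edge j<n (spoke (s≤s j≤ℓ)) with m≤n⇒m<n∨m≡n j≤ℓ
      ... | inj₁ j<ℓ = leaf-edge j<ℓ
      -- The last spoke is the edge from `p 1` to `p 2`, where the handle begins.
      ... | inj₂ refl = subst (Edge G (p 1))
        (trans (sym (vertex-tail 0)) (cong (vertex ∘ suc) (+-identityʳ ℓ))) (edge 2≤d)
      broom⇒edge {suc i} j<n (handle (s≤s ℓ≤i)) with i ∸ ℓ | m+[n∸m]≡n ℓ≤i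
      ... | k | refl = subst (λ j → Edge G (vertex (suc (ℓ + k))) (vertex (suc j))) (+-suc ℓ k)
        (tail-edge (+-cancelʳ-≤ ℓ _ _ (≤-trans (≤-reflexive (rearrange k ℓ)) (≤-trans j<n (≤-reflexive order)))))
        where
        rearrange : ∀ k ℓ → 3 + k + ℓ ≡ suc (suc (suc (ℓ + k)))
        rearrange = solve-∀

      tail-dist : ∀ {k} → 2 + k ≤ d → δ (vertex (suc (ℓ + k))) (p 1) ≡ suc k
      tail-dist {k} le = trans (cong (λ x → δ x (p 1)) (vertex-tail k)) (trans (δ-sym _ _) (δ-path tree P 1 (suc k) le))

      -- The parent of a vertex at distance 1 from `p 1` is at distance 0, hence has index 0.
      spoke⇐ : ∀ {i j} → i < n → δ (vertex (suc j)) (p 1) ≡ suc (δ (vertex i) (p 1)) →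
               δ (vertex (suc j)) (p 1) ≡ 1 → j ≤ ℓ → BroomEdge (suc ℓ) i (suc j)
      spoke⇐ {i} i<n farther one j≤ℓ = subst (λ x → BroomEdge (suc ℓ) x _)
        (sym (vertex-injective {i} {0} i<n (≤-trans (s≤s z≤n) i<n) (δ≡0⇒≡ (suc-injective (trans (sym farther) one)))))
        (spoke (s≤s j≤ℓ))

      -- Rooting at p 1, an edge joins a vertex to its unique neighbour closer to the root.
      parent⇒broom : ∀ {i j} → i < n → Label j → Edge G (vertex j) (vertex i) →
                     δ (vertex j) (p 1) ≡ suc (δ (vertex i) (p 1)) → BroomEdge (suc ℓ) i j
      parent⇒broom _ centre _ farther = contradiction (trans (sym (δ-refl (p 1))) farther) λ ()
      parent⇒broom i<n (leaf lt) _ farther = spoke⇐ i<n farther (δ-edge (edge-sym (leaf-edge lt))) (<⇒≤ lt)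
      parent⇒broom i<n (tail {zero} le) _ farther = spoke⇐ i<n farther (tail-dist le) (≤-reflexive (+-identityʳ ℓ))
      parent⇒broom {i} i<n (tail {suc k} le) e farther =
        subst₂ (BroomEdge (suc ℓ)) (sym i≡) (cong suc (sym (+-suc ℓ k))) (handle (s≤s (m≤m+n ℓ k)))
        where
        i≡ : i ≡ suc (ℓ + k)
        i≡ = vertex-injective i<n (tail<n (<⇒≤ le))
               (closer-unique {p 1} {vertex (suc (ℓ + suc k))} {vertex i} {vertex (suc (ℓ + k))}
                 e (edge-sym (tail-edge le)) farther
                 (trans (tail-dist {suc k} le) (cong suc (sym (tail-dist {k} (<⇒≤ le))))))

      edge⇒broom : ∀ {i j} → i < n → j < n → Edge G (vertex i) (vertex j) →
                   BroomEdge (suc ℓ) i j ⊎ BroomEdge (suc ℓ) j i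
      edge⇒broom {i} {j} i<n j<n e with edge-δ e (p 1)
      ... | inj₁ farther = inj₁ (parent⇒broom i<n (label j j<n) (edge-sym e) farther)
      ... | inj₂ farther = inj₂ (parent⇒broom j<n (label i i<n) e farther)

      adjacency : ∀ u v → G (H u) (H v) ≡ broom n (suc ℓ) u v
      adjacency u v = true-ext
        (λ e → T-≡ .to (broomAdj⁺ (suc ℓ) (toℕ u) (toℕ v) (edge⇒broom (toℕ<n u) (toℕ<n v) e)))
        (λ b → [ broom⇒edge (toℕ<n v) , edge-sym ∘ broom⇒edge (toℕ<n u) ]′
               (broomAdj⁻ (suc ℓ) (toℕ u) (toℕ v) (T-≡ .from b)))

    isomorphic-broom : Isomorphic G (broom n (2 + r tree P))
    isomorphic-broom = σ , λ u v → trans (cong₂ G (sym (Hσ u)) (sym (Hσ v))) (adjacency (σ ⟨$⟩ʳ u) (σ ⟨$⟩ʳ v))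
      where
      Hσ = proj₁ (proj₂ numbering)

-- Comparing the eccentricity sums of the tree and the broom

broom-eccentricitySum-≥ : ∀ s D → 2 ≤ D → n ≡ suc (s + D) →
                          s * D + pathSum D ≤ eccentricitySum (broom n (2 + s))
broom-eccentricitySum-≥ s (suc (suc m)) _ eq
  with refl ← trans eq (cong suc (+-suc s (suc m))) = broom-eccentricitySum s m
broom-eccentricitySum-≥ s (suc zero) (s≤s ()) _

module _ {G : Graph n} (tree : IsTree G) where
  open Tree G tree

  -- A vertex and its neighbours are distinct, since there are no loops.
  degree<order : ∀ c → degree G c < n
  degree<order c = begin
    suc (degree G c)              ≡⟨ cong suc (length-neighbours G c) ⟨
    length (c ∷ neighbours G c)   ≤⟨ unique-⊆⇒length≤
      (All.¬Any⇒All¬ _ (edge-irrefl ∘ ∈-neighbours⁻ G) ∷ unique-neighbours G c) (λ _ → ∈-allFin _) ⟩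
    length (allFin n)             ≡⟨ length-allFin n ⟩
    n                             ∎
    where open ≤-Reasoning

  module _ (P : DiametralPath G) where
    open DiametralPath P

    -- The bound `b` off the path is left open: it will be `d` in general and `pred d` for an inner
    -- hub.
    eccentricitySum-≤ : ∀ b → (∀ {w} → w ∈ offPath tree P → eccentricity G w ≤ b) →
                        eccentricitySum G ≤ pathSum d + r tree P * b
    eccentricitySum-≤ b h = begin
      eccentricitySum G ≡⟨ sum-map-complement (eccentricity G) (onPath tree P) (unique-onPath tree P) ⟩
      sum (map (eccentricity G) (onPath tree P)) + sum (map (eccentricity G) (offPath tree P))
        ≤⟨ +-mono-≤ (≤-reflexive (cong sum (map-applyUpTo p (eccentricity G) (suc d))))
                    (sum-map-≤ b (offPath tree P) h) ⟩
      sum (applyUpTo (eccentricity G ∘ p) (suc d)) + r tree P * b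
        ≤⟨ +-monoˡ-≤ _ (sum-applyUpTo-mono (suc d) λ j<1+d → eccentricity-≤ (δ-path-≤ tree P (≤-pred j<1+d))) ⟩
      pathSum d + r tree P * b ∎
      where open ≤-Reasoning

    -- The broom has a diameter larger by `e = r − s`: compared with the tree, `e` vertices off the
    -- path have moved onto it, and `pathSum-+` gains strictly.
    short-diameter : ∀ {s} c → degree G c ≡ 2 + s → s < r tree P →
                     eccentricitySum G < eccentricitySum (broom n (2 + s))
    short-diameter {s} c deg s<r = begin-strict
      eccentricitySum G          ≤⟨ eccentricitySum-≤ d (λ {w} _ → eccentricity-≤ (λ u → bound u w)) ⟩
      pathSum d + r tree P * d   ≡⟨ cong (λ x → pathSum d + x * d) r≡ ⟩
      pathSum d + (e + s) * d    ≡⟨ rearrange (pathSum d) e s d ⟩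
      s * d + (pathSum d + e * d)
        <⟨ +-mono-≤-< (*-monoʳ-≤ s (m≤n+m d e)) (<-≤-trans (m<m+n _ (m<n⇒0<n∸m s<r)) (pathSum-+ d e)) ⟩
      s * (e + d) + pathSum (e + d) ≤⟨ broom-eccentricitySum-≥ s (e + d) 2≤D order ⟩
      eccentricitySum (broom n (2 + s)) ∎
      where
      open ≤-Reasoning
      e = r tree P ∸ s
      r≡ : r tree P ≡ e + s
      r≡ = sym (m∸n+n≡m (<⇒≤ s<r))
      rearrange : ∀ a e s d → a + (e + s) * d ≡ s * d + (a + e * d)
      rearrange = solve-∀
      order : n ≡ suc (s + (e + d))
      order = trans (sym (order-≡ tree P)) (cong suc (trans (cong (d +_) r≡) (shuffle d e s)))
        where
        shuffle : ∀ d e s → d + (e + s) ≡ s + (e + d)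
        shuffle = solve-∀
      -- `degree<order` at `c` reads `3 + s ≤ n`, and `n` is `suc s + (e + d)`.
      2≤D : 2 ≤ e + d
      2≤D = +-cancelˡ-≤ (suc s) 2 (e + d) (≤-trans (≤-reflexive (trans (+-comm (suc s) 2) (cong suc (sym deg))))
              (≤-trans (degree<order c) (≤-reflexive order)))

    -- A vertex off the path is one step from `p k`, so its eccentricity is at most
    -- `1 + (k ⊔ (d ∸ k))`, below `d` for this `k`. The sum falls short by at least `r > 0`.
    inner-hub : ∀ {k} → 1 < k → suc k < d → (∀ {w} → w ∈ offPath tree P → Edge G (p k) w) → 0 < r tree P →
                eccentricitySum G < eccentricitySum (broom n (2 + r tree P))
    inner-hub {k} 1<k 1+k<d attached 0<r = begin-strict
      eccentricitySum G              ≤⟨ eccentricitySum-≤ (pred d) leaf-eccentricity ⟩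
      pathSum d + r tree P * pred d  ≡⟨ +-comm (pathSum d) _ ⟩
      r tree P * pred d + pathSum d
        <⟨ +-monoˡ-< (pathSum d) (*-monoʳ-< (r tree P) {{>-nonZero 0<r}}
             (≤-reflexive (suc-pred d {{>-nonZero (≤-trans (s≤s z≤n) 2≤d)}}))) ⟩
      r tree P * d + pathSum d
        ≤⟨ broom-eccentricitySum-≥ (r tree P) d 2≤d (trans (sym (order-≡ tree P)) (cong suc (+-comm d _))) ⟩
      eccentricitySum (broom n (2 + r tree P)) ∎
      where
      open ≤-Reasoning
      2≤d : 2 ≤ d
      2≤d = ≤-trans 1<k (≤-trans (m≤n+m k 2) 1+k<d)
      k≤d : k ≤ d
      k≤d = ≤-trans (m≤n+m k 2) 1+k<d
      spare : 2 + (k ⊔ (d ∸ k)) ≤ d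
      spare = ≤-trans (≤-reflexive (+-distribˡ-⊔ 2 k (d ∸ k))) (⊔-lub 1+k<d
        (≤-trans (+-monoˡ-≤ (d ∸ k) 1<k) (≤-reflexive (m+[n∸m]≡n k≤d))))
      leaf-eccentricity : ∀ {w} → w ∈ offPath tree P → eccentricity G w ≤ pred d
      leaf-eccentricity {w} w∈ = eccentricity-≤ λ u → ≤-trans (δ-triangle u (p k) w)
        (≤-trans (+-mono-≤ (δ-path-≤ tree P k≤d u) (≤-reflexive (δ-edge (attached w∈))))
          (≤-trans (≤-reflexive (+-comm _ 1)) (<⇒≤pred spare)))

    -- The vertex `p (d ∸ 1)` has index 1 on the reversed path. The vertices off the path stay the
    -- same, and `order-≡` shows that their number does too.
    isomorphic-broom-reverse : 2 ≤ d → (∀ {w} → w ∈ offPath tree P → Edge G (p (d ∸ 1)) w) →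
                               Isomorphic G (broom n (2 + r tree P))
    isomorphic-broom-reverse 2≤d attached = subst (λ x → Isomorphic G (broom n (2 + x)))
      (+-cancelˡ-≡ (suc d) _ _ (trans (order-≡ tree P′) (sym (order-≡ tree P))))
      (isomorphic-broom tree P′ 2≤d λ w∈ → attached (∈-complement⁺ (∈-complement⁻ w∈ ∘ on)))
      where
      P′ = reversePath tree P
      on : ∀ {w} → w ∈ onPath tree P → w ∈ onPath tree P′
      on w∈ with ∈-applyUpTo⁻ p w∈
      ... | j , s≤s j≤d , refl = subst (λ i → p i ∈ onPath tree P′) (m∸[m∸n]≡n j≤d)
              (∈-applyUpTo⁺ (λ j → p (d ∸ j)) (s≤s (m∸n≤m d j)))

    broom-or-less : ∀ {s} c → degree G c ≡ 2 + s →
      Isomorphic G (broom n (2 + s)) ⊎ eccentricitySum G < eccentricitySum (broom n (2 + s))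
    broom-or-less {s} c deg with attachment tree P c
    ... | small lt = inj₂ (short-diameter c deg (≤-pred (≤-pred (≤-trans (≤-reflexive (cong suc (sym deg))) lt))))
    ... | hub k 0<k k<d _ attached deg′ =
        subst (λ x → Isomorphic G (broom n x) ⊎ eccentricitySum G < eccentricitySum (broom n x))
          (trans (sym deg′) deg) full
      where
      2≤d : 2 ≤ d
      2≤d = ≤-trans (s≤s 0<k) k<d
      full : Isomorphic G (broom n (2 + r tree P)) ⊎ eccentricitySum G < eccentricitySum (broom n (2 + r tree P))
      full = [ (λ 1<k → [ (λ 1+k<d → [ inj₂ ∘ inner-hub 1<k 1+k<d attached
                                     -- Without vertices off the path the tree is a path, the broom
                                     -- with `Δ = 2`, and attachment to `p 1` is vacuous.
                                     , (λ 0≡r → inj₁ (isomorphic-broom tree P 2≤d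
                                         λ w∈ → contradiction (∈-length w∈) (<-irrefl 0≡r))) ]′
                                     (m≤n⇒m<n∨m≡n {0} {r tree P} z≤n))
                        , (λ 1+k≡d → inj₁ (isomorphic-broom-reverse 2≤d
                            λ {w} w∈ → subst (λ i → Edge G (p (i ∸ 1)) w) 1+k≡d (attached w∈))) ]′
                        (m≤n⇒m<n∨m≡n k<d))
             , (λ 1≡k → inj₁ (isomorphic-broom tree P 2≤d
                 λ {w} w∈ → subst (λ i → Edge G (p i) w) (sym 1≡k) (attached w∈))) ]′
             (m≤n⇒m<n∨m≡n 0<k)

-- Trees of maximum degree 1

module _ {G : Graph n} (tree : IsTree G) (deg≤1 : ∀ v → degree G v ≤ 1) where
  open Tree G tree
  only : ∀ {v y z} → Edge G v y → Edge G v z → y ≡ z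
  only {v} {y} {z} ey ez with y ≟ z
  ... | yes eq = eq
  ... | no y≢z = contradiction (≤-trans (unique-⊆⇒length≤ {xs = y ∷ z ∷ []} ((y≢z ∷ []) ∷ [] ∷ []) sub)
                   (≤-trans (≤-reflexive (length-neighbours G v)) (deg≤1 v))) 1+n≰n
    where
    sub : y ∷ z ∷ [] ⊆ neighbours G v
    sub (here refl) = ∈-neighbours⁺ G ey
    sub (there (here refl)) = ∈-neighbours⁺ G ez
  -- With all degrees at most 1, a walk from `c` can only go back and forth along one edge.
  cover : ∀ {c x} → Edge G c x → ∀ z → z ∈ c ∷ x ∷ []
  cover {c} {x} e z = reach (proj₂ (proj₁ (proj₂ tree) c z)) (here refl)
    where
    reach : ∀ {u v k} → Walk G u v k → u ∈ c ∷ x ∷ [] → v ∈ c ∷ x ∷ []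
    reach here u∈ = u∈
    reach (step e′ w) (here refl) = reach w (there (here (only e′ e)))
    reach (step e′ w) (there (here refl)) = reach w (here (only e′ (edge-sym e)))

  order≡2 : ∀ {c} → degree G c ≡ 1 → n ≡ 2 × ∃ λ x → Edge G c x
  order≡2 {c} deg = ≤-antisym
      (≤-trans (≤-reflexive (sym (length-allFin n))) (unique-⊆⇒length≤ (unique-allFin n) (λ {z} _ → cover e z)))
      (≤-trans (≤-reflexive (cong suc (sym deg))) (degree<order tree c)) , x , e
    where
    some : ∀ (xs : List (Fin n)) → length xs ≡ 1 → ∃ (_∈ xs)
    some (x ∷ _) _ = x , here refl
    neighbour = some (neighbours G c) (trans (length-neighbours G c) deg)
    x = proj₁ neighbour
    e : Edge G c x
    e = ∈-neighbours⁻ G (proj₂ neighbour)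

-- On two vertices the edge determines the whole adjacency matrix, so the identity is an
-- isomorphism.
isomorphic-K₂ : n ≡ 2 → (G : Graph n) → IsSimple G → ∀ {c x} → Edge G c x → Isomorphic G (broom n 1)
isomorphic-K₂ refl G (symmetric , loopless) {c} {x} e = Permutation.id , λ where
    fzero fzero → loopless fzero
    fzero (fsuc fzero) → edge₀₁ c x e
    (fsuc fzero) fzero → trans (symmetric (fsuc fzero) fzero) (edge₀₁ c x e)
    (fsuc fzero) (fsuc fzero) → loopless (fsuc fzero)
  where
  edge₀₁ : ∀ c x → Edge G c x → Edge G fzero (fsuc fzero)
  edge₀₁ fzero fzero e = contradiction (trans (sym e) (loopless fzero)) λ ()
  edge₀₁ fzero (fsuc fzero) e = e
  edge₀₁ (fsuc fzero) fzero e = trans (symmetric fzero (fsuc fzero)) e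
  edge₀₁ (fsuc fzero) (fsuc fzero) e = contradiction (trans (sym e) (loopless (fsuc fzero))) λ ()

isomorphic-broom-1 : (G : Graph n) → IsTree G → MaxDegree G 1 → Isomorphic G (broom n 1)
isomorphic-broom-1 G tree (deg≤1 , c , deg) =
  let n≡2 , x , e = order≡2 tree deg≤1 {c} deg in isomorphic-K₂ n≡2 G (proj₁ tree) e

-- From eccentricity sums to averages

/-mono-< : ∀ {a b} n .{{_ : NonZero n}} → a < b → (ℤ.+ b) / n > (ℤ.+ a) / n
/-mono-< {a} {b} (suc n) a<b = toℚᵘ-cancel-< (ℚᵘ.<-respˡ-≃ (ℚᵘ.≃-sym (toℚᵘ-fromℚᵘ (mkℚᵘ (ℤ.+ a) n)))
  (ℚᵘ.<-respʳ-≃ (ℚᵘ.≃-sym (toℚᵘ-fromℚᵘ (mkℚᵘ (ℤ.+ b) n))) (*<* (*-monoʳ-<-pos (ℤ.+ suc n) (ℤ.+<+ a<b)))))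

mainTheorem2 : (n Δ : ℕ) .{{_ : NonZero n}} (T : Graph n) → 1 ≤ Δ →
    IsTree T → MaxDegree T Δ → ¬ Isomorphic T (broom n Δ) →
    ecc (broom n Δ) > ecc T
-- For `Δ = 1` the tree is a single edge, which is itself the broom.
mainTheorem2 n (suc zero) T _ tree max ¬iso = contradiction (isomorphic-broom-1 T tree max) ¬iso
mainTheorem2 n (suc (suc s)) T _ tree (_ , c , deg) ¬iso =
  [ (λ iso → contradiction iso ¬iso) , /-mono-< n ]′ (broom-or-less tree (diametralPath tree c) c deg)
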